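{- Let $d\ge 1$ and let $\mathcal{F}$ be a family of axis-parallel boxes in $\mathbb{R}^d$. If among every $\aleph_0$ of them some $2$ can be intersected with an axis-parallel hyperplane, then all the members of $\mathcal{F}$ can be hit by finitely many axis-parallel hyperplanes.
   Context: An axis-parallel box in $\mathbb{R}^d$ is a set $[a_1,b_1]\times\cdots\times[a_d,b_d]$ with real $a_i\le b_i$. An axis-parallel hyperplane is a set $\{x\in\mathbb{R}^d : x_i=c\}$ for some $i\in\{1,\dots,d\}$ and $c\in\mathbb{R}$. A hyperplane hits a set if it intersects it. The hypothesis means that every infinite subfamily of $\mathcal{F}$ contains two distinct boxes intersected by one common axis-parallel hyperplane. -}

module Defs where

open import Level using (0ℓ; suc; _⊔_)
open import Data.List using (List)
open import Data.List.Relation.Unary.Any using (Any)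
open import Data.Nat using (ℕ)
open import Data.Fin using (Fin)
open import Data.Product using (∃; ∃₂; _×_)
open import Data.Rational using (ℚ; _<_)
open import Data.Sum using (_⊎_)
open import Data.Vec.Functional using (Vector)
open import Function using (_⇔_; Injective)
open import Relation.Binary using (Rel)
open import Relation.Binary.PropositionalEquality using (_≡_; _≢_)
open import Relation.Nullary using (¬_)
open import Relation.Unary using (Pred; Satisfiable; _∈_; _⊆_; _≐_; _≬_)

-- Real numbers as two-sided Dedekind cuts of ℚ.  Only the order of ℝ is
-- needed, and equality of reals is _≃_, not _≡_.

record ℝ : Set₁ where
  field
    lower : Pred ℚ 0ℓ
    upper : Pred ℚ 0ℓ
    lower-inhabited : Satisfiable lower
    upper-inhabited : Satisfiable upper
    lower-rounded : ∀ q → q ∈ lower ⇔ ∃ λ r → q < r × r ∈ lower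
    upper-rounded : ∀ r → r ∈ upper ⇔ ∃ λ q → q < r × q ∈ upper
    disjoint : ∀ q → ¬ (q ∈ lower × q ∈ upper)
    located : ∀ q r → q < r → q ∈ lower ⊎ r ∈ upper

open ℝ public

infix 4 _≤ℝ_ _≃_

_≤ℝ_ : Rel ℝ 0ℓ
x ≤ℝ y = lower x ⊆ lower y

_≃_ : Rel ℝ 0ℓ
x ≃ y = x ≤ℝ y × y ≤ℝ x

Point : ℕ → Set₁
Point d = Vector ℝ d

record Box (d : ℕ) : Set₁ where
  field
    lo    : Vector ℝ d
    hi    : Vector ℝ d
    lo≤hi : ∀ i → lo i ≤ℝ hi i

open Box public

⟦_⟧ : ∀ {d} → Box d → Pred (Point d) 0ℓ
⟦ B ⟧ x = ∀ i → lo B i ≤ℝ x i × x i ≤ℝ hi B i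

-- Boxes are compared as sets of points: _≡_ on Box would distinguish
-- different presentations of the same cuts.

infix 4 _≈_

_≈_ : ∀ {d} → Rel (Box d) (suc 0ℓ)
B ≈ C = ⟦ B ⟧ ≐ ⟦ C ⟧

record Hyperplane (d : ℕ) : Set₁ where
  field
    axis   : Fin d
    offset : ℝ

open Hyperplane public

⟪_⟫ : ∀ {d} → Hyperplane d → Pred (Point d) 0ℓ
⟪ H ⟫ x = x (axis H) ≃ offset H

infix 4 _hits_

_hits_ : ∀ {d} → Hyperplane d → Box d → Set₁
H hits B = ⟪ H ⟫ ≬ ⟦ B ⟧

-- "ℵ₀ of the members" is an injective sequence of members of 𝓕.

AmongEveryℵ₀SomeTwoHit : ∀ {d ℓ} → Pred (Box d) ℓ → Set (suc 0ℓ ⊔ ℓ)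
AmongEveryℵ₀SomeTwoHit {d} 𝓕 =
  (B : ℕ → Box d) → (∀ n → B n ∈ 𝓕) → Injective _≡_ _≈_ B →
  ∃₂ λ m n → m ≢ n × ∃ λ H → H hits B m × H hits B n

FinitelyHit : ∀ {d ℓ} → Pred (Box d) ℓ → Set (suc 0ℓ ⊔ ℓ)
FinitelyHit {d} 𝓕 =
  ∃ λ (Hs : List (Hyperplane d)) → ∀ B → B ∈ 𝓕 → Any (_hits B) Hs

{-# OPTIONS --safe #-}

-- A set of boxes is called large if it contains all of 𝓕 up to a part that is
-- hit by finitely many hyperplanes.  If 𝓕 itself is not finitely hit, this is a
-- proper filter.  On each axis i it can be extended to a proper filter that
-- decides, for every rational c, whether almost all boxes lie to the left or to
-- the right of c, so almost all boxes converge on axis i to an extended real pᵢ.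
-- Almost all boxes also avoid pᵢ, and a box avoiding every pᵢ is separated on
-- every axis from almost all boxes.  Greedy choice then yields infinitely many
-- boxes no two of which are hit by a common hyperplane.

module Submission where

open import Defs
open import Level using (Level; 0ℓ; suc; _⊔_; lift; lower)
open import Axiom.ExcludedMiddle using (ExcludedMiddle)
open import Data.Empty using (⊥-elim)
open import Data.Fin as Fin using (Fin)
open import Data.Fin.Properties using () renaming (_≟_ to _≟ᶠ_)
open import Data.List using (List; []; _∷_; _++_; allFin)
open import Data.List.Membership.Propositional using () renaming (_∈_ to _∈ᴸ_)
open import Data.List.Membership.Propositional.Properties using (∈-allFin)
open import Data.List.Relation.Unary.All as All using (All; []; _∷_)
open import Data.List.Relation.Unary.Any using (Any; here; there)
open import Data.List.Relation.Unary.Any.Properties using (++⁺ˡ; ++⁺ʳ)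
open import Data.Nat as ℕ using (ℕ; _≤_; s≤s)
import Data.Nat.Properties as ℕ
open import Data.Product using (∃; _×_; _,_; proj₁; proj₂)
open import Data.Rational as ℚ using (ℚ; 1ℚ; _<_)
import Data.Rational.Properties as ℚ
open import Data.Sum as Sum using (_⊎_; inj₁; inj₂; [_,_]′)
open import Data.Unit using (tt)
open import Data.Vec.Functional using (updateAt)
open import Data.Vec.Functional.Properties using (updateAt-updates; updateAt-minimal)
open import Function using (Injective; mk⇔; const; id; _∘_)
open import Function.Bundles using (Equivalence)
open import Relation.Binary using (Rel)
open import Relation.Binary.PropositionalEquality using (_≡_; _≢_; refl; sym; subst)
open import Relation.Nullary using (¬_; Dec; yes; no; contradiction)
open import Relation.Nullary.Decidable using (True; toWitness; fromWitness; map′; decidable-stable)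
open import Relation.Unary using (Pred; Decidable; Satisfiable; _∈_; _∉_; _∩_; _∪_; _⇒_; ∅; U)

private
  variable
    a p r : Level
    d : ℕ

-- Sequences from greedy choice

greedy-sequence : {A : Set a} {P : Pred A p} {R : Rel A r} →
  (∀ xs → All P xs → ∃ λ y → P y × All (λ x → R x y) xs) →
  ∃ λ (f : ℕ → A) → (∀ n → P (f n)) × (∀ {m n} → m ℕ.< n → R (f m) (f n))
greedy-sequence {A = A} {P = P} next =
  f , (λ n → proj₁ (proj₂ (step n)))
    , λ {_} {n} m<n → All.lookup (proj₂ (proj₂ (step n))) (f∈prefix m<n)
  where
  -- All earlier choices are carried along, since the next one must be related to each of them.
  prefix : ℕ → ∃ (All P)
  step : ∀ n → _
  step n = next (proj₁ (prefix n)) (proj₂ (prefix n))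

  prefix ℕ.zero    = [] , []
  prefix (ℕ.suc n) = proj₁ (step n) ∷ proj₁ (prefix n) , proj₁ (proj₂ (step n)) ∷ proj₂ (prefix n)

  f : ℕ → A
  f n = proj₁ (step n)

  f∈prefix : ∀ {m n} → m ℕ.< n → f m ∈ᴸ proj₁ (prefix n)
  f∈prefix {m} {ℕ.suc n} (s≤s m≤n) with ℕ.m≤n⇒m<n∨m≡n m≤n
  ... | inj₁ m<n  = there (f∈prefix m<n)
  ... | inj₂ refl = here refl

-- Dedekind cuts and rational reals

lower-< : ∀ (x : ℝ) {q r} → q < r → r ∈ lower x → q ∈ lower x
lower-< x q<r r∈ = Equivalence.from (lower-rounded x _) (_ , q<r , r∈)

lower-next : ∀ (x : ℝ) {q} → q ∈ lower x → ∃ λ r → q < r × r ∈ lower x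
lower-next x = Equivalence.to (lower-rounded x _)

upper-< : ∀ (x : ℝ) {q r} → q < r → q ∈ upper x → r ∈ upper x
upper-< x q<r q∈ = Equivalence.from (upper-rounded x _) (_ , q<r , q∈)

upper-next : ∀ (x : ℝ) {r} → r ∈ upper x → ∃ λ q → q < r × q ∈ upper x
upper-next x = Equivalence.to (upper-rounded x _)

-- L need not be rounded: the cut at L is its supremum.
module _ {L : Pred ℚ 0ℓ} (L? : Decidable L) (L-down : ∀ {q r} → q < r → r ∈ L → q ∈ L) where

  Below Above : Pred ℚ 0ℓ
  Below q = ∃ λ r → q < r × r ∈ L
  Above r = ∃ λ q → q < r × q ∉ L

  cut : Satisfiable Below → Satisfiable Above → ℝ
  cut below above = record
    { lower           = Below
    ; upper           = Above
    ; lower-inhabited = below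
    ; upper-inhabited = above
    ; lower-rounded   = λ q → mk⇔
        (λ (r , q<r , r∈) → let m , q<m , m<r = ℚ.<-dense q<r in m , q<m , r , m<r , r∈)
        (λ (m , q<m , r , m<r , r∈) → r , ℚ.<-trans q<m m<r , r∈)
    ; upper-rounded   = λ r → mk⇔
        (λ (q , q<r , q∉) → let m , q<m , m<r = ℚ.<-dense q<r in m , m<r , q , q<m , q∉)
        (λ (m , m<r , q , q<m , q∉) → q , ℚ.<-trans q<m m<r , q∉)
    ; disjoint        = λ m ((r , m<r , r∈) , (q , q<m , q∉)) → q∉ (L-down (ℚ.<-trans q<m m<r) r∈)
    ; located         = λ q r q<r → let m , q<m , m<r = ℚ.<-dense q<r in located′ q<m m<r (L? m)
    }
    where
    located′ : ∀ {q m r} → q < m → m < r → Dec (m ∈ L) → q ∈ Below ⊎ r ∈ Above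
    located′ q<m m<r (yes m∈) = inj₁ (_ , q<m , m∈)
    located′ q<m m<r (no m∉)  = inj₂ (_ , m<r , m∉)

fromℚ : ℚ → ℝ
fromℚ c = cut (ℚ._≤? c) (λ q<r → ℚ.≤-trans (ℚ.<⇒≤ q<r))
  (c ℚ.- 1ℚ , c , c-1<c , ℚ.≤-refl)
  -- `c` itself lies in the set being cut, so the point outside it is taken strictly above `c`.
  (let m , c<m , m<c+1 = ℚ.<-dense c<c+1 in c ℚ.+ 1ℚ , m , m<c+1 , λ m≤c → ℚ.<-irrefl refl (ℚ.<-≤-trans c<m m≤c))
  where
  c-1<c : c ℚ.- 1ℚ < c
  c-1<c = subst (c ℚ.- 1ℚ <_) (ℚ.+-identityʳ c) (ℚ.+-monoʳ-< c (ℚ.negative⁻¹ (ℚ.- 1ℚ)))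

  c<c+1 : c < c ℚ.+ 1ℚ
  c<c+1 = subst (_< c ℚ.+ 1ℚ) (ℚ.+-identityʳ c) (ℚ.+-monoʳ-< c (ℚ.positive⁻¹ 1ℚ))

≤fromℚ : ∀ {x c} → c ∉ lower x → x ≤ℝ fromℚ c
≤fromℚ {x} c∉ q∈ with lower-next x q∈
... | r , q<r , r∈ = r , q<r , ℚ.≮⇒≥ λ c<r → c∉ (lower-< x c<r r∈)

fromℚ≤ : ∀ {x c} → c ∉ upper x → fromℚ c ≤ℝ x
fromℚ≤ {x} c∉ (r , q<r , r≤c) with located x _ _ (ℚ.<-≤-trans q<r r≤c)
... | inj₁ q∈ = q∈
... | inj₂ c∈ = contradiction c∈ c∉

-- Position of a box along one axis

Left Right : Fin d → ℚ → Pred (Box d) 0ℓ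
Left  i c B = c ∈ upper (hi B i)
Right i c B = c ∈ lower (lo B i)

Contains Avoids : Fin d → ℝ → Pred (Box d) 0ℓ
Contains i x B = lo B i ≤ℝ x × x ≤ℝ hi B i
Avoids i x B = ¬ Contains i x B

Right-< : ∀ {i : Fin d} {q r B} → q < r → B ∈ Right i r → B ∈ Right i q
Right-< {i = i} {B = B} = lower-< (lo B i)

Left-≤ : ∀ {i : Fin d} {q r B} → q ℚ.≤ r → B ∈ Left i q → B ∈ Left i r
Left-≤ {i = i} {q} {r} {B} q≤r q∈ with upper-next (hi B i) q∈
... | s , s<q , s∈ = upper-< (hi B i) (ℚ.<-≤-trans s<q q≤r) s∈

-- The separator is rational because quantifying over `ℝ` would lift the relation out of `Set`,
-- where `Large` expects its predicates.
Separated : Fin d → Rel (Box d) 0ℓ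
Separated i A B = ∃ λ c → (A ∈ Left i c × B ∈ Right i c) ⊎ (A ∈ Right i c × B ∈ Left i c)

Separated⇒disjoint : ∀ {i : Fin d} {A B} → Separated i A B → ∀ {x} → A ∈ Contains i x → B ∉ Contains i x
Separated⇒disjoint {i = i} {A} {B} (c , inj₁ (A<c , c<B)) (_ , x≤A) (B≤x , _) =
  disjoint (hi A i) c (x≤A (B≤x c<B) , A<c)
Separated⇒disjoint {i = i} {A} {B} (c , inj₂ (c<A , B<c)) (A≤x , _) (_ , x≤B) =
  disjoint (hi B i) c (x≤B (A≤x c<A) , B<c)

lo∈ : (B : Box d) → lo B ∈ ⟦ B ⟧
lo∈ B i = id , lo≤hi B i

through : Fin d → ℝ → Hyperplane d
through i x = record { axis = i ; offset = x }

Contains⇒hits : ∀ {i : Fin d} {x B} → B ∈ Contains i x → through i x hits B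
Contains⇒hits {i = i} {x} {B} x∈B =
  y , subst (λ z → z ≤ℝ x × x ≤ℝ z) (sym y-i) (id , id) , y∈B
  where
  -- The corner `lo B`, moved to `x` on axis `i` only.
  y = updateAt (lo B) i (const x)
  y-i = updateAt-updates i {const x} (lo B)
  y∈B : y ∈ ⟦ B ⟧
  y∈B j with j ≟ᶠ i
  ... | yes refl = subst (λ z → B ∈ Contains i z) (sym y-i) x∈B
  ... | no j≢i   = subst (λ z → B ∈ Contains j z) (sym (updateAt-minimal j i {const x} (lo B) j≢i)) (lo∈ B j)

hits⇒Contains : ∀ {H : Hyperplane d} {B} → H hits B → B ∈ Contains (axis H) (offset H)
hits⇒Contains {H = H} (x , (x≤h , h≤x) , x∈B) with x∈B (axis H)
... | lo≤x , x≤hi = x≤h ∘ lo≤x , x≤hi ∘ h≤x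

-- Pairwise separated sequences of boxes

SeparatedSequence : ∀ {ℓ} → Pred (Box d) ℓ → Set (suc 0ℓ ⊔ ℓ)
SeparatedSequence {d} 𝓕 = ∃ λ (B : ℕ → Box d) →
  (∀ n → B n ∈ 𝓕) × (∀ {m n} → m ℕ.< n → ∀ i → Separated i (B m) (B n))

SeparatedSequence⇒¬SomeTwoHit : ∀ {ℓ} {𝓕 : Pred (Box (ℕ.suc d)) ℓ} →
  SeparatedSequence 𝓕 → ¬ AmongEveryℵ₀SomeTwoHit 𝓕
SeparatedSequence⇒¬SomeTwoHit (B , B∈𝓕 , separated) some-two =
  let m , n , m≢n , H , hits-m , hits-n = some-two B B∈𝓕 injective in
  disjoint-≢ m≢n (axis H) (offset H) (hits⇒Contains {H = H} {B m} hits-m) (hits⇒Contains {H = H} {B n} hits-n)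
  where
  disjoint-≢ : ∀ {m n} → m ≢ n → ∀ i x → B m ∈ Contains i x → B n ∉ Contains i x
  disjoint-≢ {m} {n} m≢n i x x∈m x∈n with ℕ.≤-total m n
  ... | inj₁ m≤n = Separated⇒disjoint {i = i} {B m} {B n} (separated (ℕ.≤∧≢⇒< m≤n m≢n) i) {x} x∈m x∈n
  ... | inj₂ n≤m = Separated⇒disjoint {i = i} {B n} {B m} (separated (ℕ.≤∧≢⇒< n≤m (m≢n ∘ sym)) i) {x} x∈n x∈m

  -- Boxes equal as sets share the corner `lo (B m)`, which separation on axis zero forbids; that
  -- axis exists because the dimension is a successor.
  injective : Injective _≡_ _≈_ B
  injective {m} {n} (m⊆n , _) = decidable-stable (m ℕ.≟ n) λ m≢n →
    disjoint-≢ m≢n Fin.zero (lo (B m) Fin.zero) (lo∈ (B m) Fin.zero) (m⊆n {lo (B m)} (lo∈ (B m)) Fin.zero)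

-- Filters of large sets of boxes

module _ {ℓ} (em : ExcludedMiddle (suc 0ℓ ⊔ ℓ)) {d} (𝓕 : Pred (Box d) ℓ) where

  em₀ : ExcludedMiddle 0ℓ
  em₀ = map′ lower (lift {ℓ = suc 0ℓ ⊔ ℓ}) em

  -- `large-mono` compares predicates only on members of `𝓕`, so largeness depends only on the trace
  -- on `𝓕`.
  record Filter : Set (suc (suc 0ℓ ⊔ ℓ)) where
    field
      Large       : Pred (Pred (Box d) 0ℓ) (suc 0ℓ ⊔ ℓ)
      large-mono  : ∀ {P Q} → (∀ B → B ∈ 𝓕 → B ∈ P → B ∈ Q) → Large P → Large Q
      large-∩     : ∀ {P Q} → Large P → Large Q → Large (P ∩ Q)
      large-U     : Large U
      ¬large-∅    : ¬ Large ∅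
      large-avoid : ∀ i x → Large (Avoids i x)

    large-mono′ : ∀ {P Q} → (∀ B → B ∈ P → B ∈ Q) → Large P → Large Q
    large-mono′ P⊆Q = large-mono λ B _ → P⊆Q B

    large⇒member : ∀ {P} → Large P → ∃ λ B → B ∈ 𝓕 × B ∈ P
    large⇒member large =
      decidable-stable em λ ¬∃ → ¬large-∅ (large-mono (λ B B∈𝓕 B∈P → ¬∃ (B , B∈𝓕 , B∈P)) large)

    large-Fin : ∀ {n} {P : Fin n → Pred (Box d) 0ℓ} →
      (∀ i → Large (P i)) → Large (λ B → ∀ i → B ∈ P i)
    large-Fin {ℕ.zero}  _     = large-mono′ (λ _ _ ()) large-U
    large-Fin {ℕ.suc n} large = large-mono′
      (λ { B (z , s) Fin.zero → z ; B (z , s) (Fin.suc i) → s i })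
      (large-∩ (large Fin.zero) (large-Fin (large ∘ Fin.suc)))

    -- All over a list of boxes lives in Set₁, so it is not itself a Pred (Box d) 0ℓ.
    large-All : ∀ {As : List (Box d)} {R : Rel (Box d) 0ℓ} → All (λ A → Large (R A)) As →
      ∃ λ P → Large P × (∀ B → B ∈ P → All (λ A → R A B) As)
    large-All []       = U , large-U , λ _ _ → []
    large-All (l ∷ ls) =
      let P , large , all = large-All ls
      in _ , large-∩ l large , λ B (r , B∈P) → r ∷ all B B∈P

    Decides : Pred (Fin d) (suc 0ℓ ⊔ ℓ)
    Decides i = ∀ c → Large (Right i c) ⊎ Large (Left i c)

    -- Both sides are strict, so a box on neither side contains `fromℚ c`, and almost all boxes
    -- avoid that point.
    large-Left∪Right : ∀ i c → Large (Left i c ∪ Right i c)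
    large-Left∪Right i c = large-mono′ side (large-avoid i (fromℚ c))
      where
      side : ∀ B → B ∈ Avoids i (fromℚ c) → B ∈ Left i c ∪ Right i c
      side B c∉B with em₀ {B ∈ Left i c} | em₀ {B ∈ Right i c}
      ... | yes l | _     = inj₁ l
      ... | no _  | yes r = inj₂ r
      ... | no ¬l | no ¬r = ⊥-elim (c∉B (≤fromℚ {lo B i} ¬r , fromℚ≤ {hi B i} ¬l))

  -- Extension to a filter deciding every axis

  open Filter using (Large; Decides)

  _⊑_ : Rel Filter _
  𝒰 ⊑ 𝒱 = ∀ {P} → Large 𝒰 P → Large 𝒱 P

  Decides-⊑ : ∀ {𝒰 𝒱} → 𝒰 ⊑ 𝒱 → ∀ {i} → Decides 𝒰 i → Decides 𝒱 i
  Decides-⊑ 𝒰⊑𝒱 dec c = Sum.map 𝒰⊑𝒱 𝒰⊑𝒱 (dec c)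

  -- Properness is exactly `¬hit`, and intersections concatenate the lists of exceptional
  -- hyperplanes.
  cofinite : ¬ FinitelyHit 𝓕 → Filter
  cofinite ¬hit = record
    { Large       = λ P → ∃ λ Hs → ∀ B → B ∈ 𝓕 → B ∈ P ⊎ Any (_hits B) Hs
    ; large-mono  = λ P⊆Q (Hs , f) → Hs , λ B B∈ → Sum.map₁ (P⊆Q B B∈) (f B B∈)
    ; large-∩     = λ {P} {Q} (Hs , f) (Ks , g) → Hs ++ Ks , λ B B∈ → both {P} {Q} Hs (f B B∈) (g B B∈)
    ; large-U     = [] , λ _ _ → inj₁ tt
    ; ¬large-∅    = λ (Hs , f) → ¬hit (Hs , λ B B∈ → [ ⊥-elim , id ]′ (f B B∈))
    ; large-avoid = λ i x → through i x ∷ [] , λ B _ → avoid-or-hit i x B em₀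
    }
    where
    both : ∀ {P Q : Pred (Box d) 0ℓ} {B} Hs {Ks} → B ∈ P ⊎ Any (_hits B) Hs → B ∈ Q ⊎ Any (_hits B) Ks →
      B ∈ P ∩ Q ⊎ Any (_hits B) (Hs ++ Ks)
    both Hs (inj₁ p) (inj₁ q) = inj₁ (p , q)
    both Hs (inj₁ _) (inj₂ k) = inj₂ (++⁺ʳ Hs k)
    both Hs (inj₂ h) _        = inj₂ (++⁺ˡ h)

    avoid-or-hit : ∀ i x B → Dec (B ∈ Contains i x) → B ∈ Avoids i x ⊎ Any (_hits B) (through i x ∷ [])
    avoid-or-hit i x B (yes x∈B) = inj₂ (here (Contains⇒hits {i = i} {x} {B} x∈B))
    avoid-or-hit i x B (no x∉B)  = inj₁ x∉B

  -- Adjoining the sets Left i q that are not already excluded keeps the filter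
  -- proper, because these sets form a chain.
  decide : ∀ i 𝒰 → ∃ λ 𝒱 → 𝒰 ⊑ 𝒱 × Decides 𝒱 i
  decide i 𝒰 with em {∀ c → Large 𝒰 (Right i c)}
  -- Here the limit on axis `i` is plus infinity and `𝒰` already decides.
  ... | yes right = 𝒰 , id , inj₁ ∘ right
  ... | no ¬right = 𝒱 , embed , decides
    where
    open Filter 𝒰 hiding (Large; Decides)

    start : ∃ λ c → ¬ Large 𝒰 (Right i c)
    start = decidable-stable em λ ¬∃ → ¬right λ c → decidable-stable em λ ¬l → ¬∃ (c , ¬l)

    Large′ : Pred (Pred (Box d) 0ℓ) (suc 0ℓ ⊔ ℓ)
    Large′ P = ∃ λ q → ¬ Large 𝒰 (Right i q) × Large 𝒰 (Left i q ⇒ P)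

    embed : ∀ {P} → Large 𝒰 P → Large′ P
    embed l = proj₁ start , proj₂ start , large-mono′ (λ _ → const) l

    intersect : ∀ {P Q} → Large′ P → Large′ Q → Large′ (P ∩ Q)
    intersect (q , ¬q , l) (r , ¬r , m) with ℚ.≤-total q r
    ... | inj₁ q≤r = q , ¬q , large-mono′ (λ B (f , g) x → f x , g (Left-≤ {B = B} q≤r x)) (large-∩ l m)
    ... | inj₂ r≤q = r , ¬r , large-mono′ (λ B (f , g) x → f (Left-≤ {B = B} r≤q x) , g x) (large-∩ l m)

    𝒱 : Filter
    𝒱 = record
      { Large       = Large′
      ; large-mono  = λ P⊆Q (q , ¬q , l) → q , ¬q , large-mono (λ B B∈ f → P⊆Q B B∈ ∘ f) l
      ; large-∩     = intersect
      ; large-U     = embed large-U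
      -- If almost no box were left of `q`, almost all would be right of `q`, against the choice of
      -- `q`.
      ; ¬large-∅    = λ (q , ¬q , l) → ¬q (large-mono′
          (λ { B (f , inj₁ x) → ⊥-elim (f x) ; B (f , inj₂ x) → x })
          (large-∩ l (large-Left∪Right i q)))
      ; large-avoid = λ j x → embed (large-avoid j x)
      }

    decides : Decides 𝒱 i
    decides c with em {Large 𝒰 (Right i c)}
    ... | yes r = inj₁ (embed r)
    ... | no ¬r = inj₂ (c , ¬r , large-mono′ (λ _ _ → id) large-U)

  -- Axes can be treated one by one because a decision survives every extension.
  decide-list : ∀ is → Filter → ∃ λ 𝒱 → All (Decides 𝒱) is
  decide-list []       𝒰 = 𝒰 , []
  decide-list (i ∷ is) 𝒰 =
    let 𝒱 , all     = decide-list is 𝒰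
        𝒲 , 𝒱⊑𝒲 , dec = decide i 𝒱
    in 𝒲 , dec ∷ All.map (Decides-⊑ {𝒱} {𝒲} 𝒱⊑𝒲) all

  -- Limits on the axes and the separated sequence

  module _ (𝒰 : Filter) where
    open Filter 𝒰 hiding (Large; Decides)

    -- P holds of the boxes that avoid the limit of 𝒰 on axis i (all boxes if it is ±∞).
    large-separated : ∀ {i} → Decides 𝒰 i →
      ∃ λ P → Large 𝒰 P × (∀ A → A ∈ P → Large 𝒰 (Separated i A))
    large-separated {i} dec = limit (em₀ {Satisfiable below}) (em₀ {Satisfiable above})
      where
      -- The supremum of `L` is the limit on axis `i`. `True` of the decision brings `Large` down to
      -- the level that a cut requires.
      L : Pred ℚ 0ℓ
      L c = True (em {Large 𝒰 (Right i c)})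

      L? : Decidable L
      L? c = em₀

      L-down : ∀ {q r} → q < r → r ∈ L → q ∈ L
      L-down q<r r∈ = fromWitness (large-mono′ (λ B → Right-< {B = B} q<r) (toWitness r∈))

      below above : Pred ℚ 0ℓ
      below = Below L? L-down
      above = Above L? L-down

      ∉L⇒left : ∀ {c} → c ∉ L → Large 𝒰 (Left i c)
      ∉L⇒left {c} c∉ = [ (λ r → contradiction (fromWitness r) c∉) , id ]′ (dec c)

      -- `c ∉ below` excludes from `L` only rationals above `c`, hence the step up to `r`.
      left-of : ∀ {A c} → c ∈ lower (lo A i) → c ∉ below → Large 𝒰 (Separated i A)
      left-of {A} c∈ c∉ with lower-next (lo A i) c∈
      ... | r , c<r , r∈ = large-mono′ (λ B l → r , inj₂ (r∈ , l)) (∉L⇒left λ r∈L → c∉ (r , c<r , r∈L))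

      right-of : ∀ {A c} → c ∈ upper (hi A i) → c ∈ L → Large 𝒰 (Separated i A)
      right-of c∈ c∈L = large-mono′ (λ B r → _ , inj₁ (c∈ , r)) (toWitness c∈L)

      limit : Dec (Satisfiable below) → Dec (Satisfiable above) →
        ∃ λ P → Large 𝒰 P × (∀ A → A ∈ P → Large 𝒰 (Separated i A))
      -- Limit minus infinity: some rational lies to the left of `A`.
      limit (no ¬b) _ = U , large-U , λ A _ →
        let c , c∈ = lower-inhabited (lo A i) in left-of {A} c∈ λ c∈b → ¬b (c , c∈b)
      -- Limit plus infinity, symmetrically.
      limit (yes _) (no ¬a) = U , large-U , λ A _ →
        let c , c∈       = upper-inhabited (hi A i)
            q , q<c , q∈ = upper-next (hi A i) c∈
        in right-of {A} q∈ (decidable-stable em₀ λ q∉ → ¬a (c , q , q<c , q∉))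
      limit (yes b) (yes a) = Avoids i x , large-avoid i x , separate
        where
        x : ℝ
        x = cut L? L-down b a

        separate : ∀ A → A ∈ Avoids i x → Large 𝒰 (Separated i A)
        separate A x∉A with em₀ {∃ λ q → q ∈ lower (lo A i) × q ∉ below}
        ... | yes (q , q∈ , q∉) = left-of {A} q∈ q∉
        -- Now `lo A i ≤ℝ x`. Without separation, locatedness of `hi A i` would give `x ≤ℝ hi A i`
        -- too, so `A` would contain `x`.
        ... | no ¬∃ = decidable-stable em λ ¬sep → x∉A
          ( (λ q∈ → decidable-stable em₀ λ q∉ → ¬∃ (_ , q∈ , q∉))
          , λ (r , q<r , r∈L) →
              [ id , (λ r∈ → contradiction (right-of {A} r∈ r∈L) ¬sep) ]′ (located (hi A i) _ _ q<r) )

    separated-sequence : (∀ i → Decides 𝒰 i) → SeparatedSequence 𝓕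
    separated-sequence dec =
      let B , good , sep = greedy-sequence next in B , proj₁ ∘ good , sep
      where
      -- The second component keeps the greedy choice going: finitely many good boxes leave a large
      -- set of boxes separated from all of them, and almost all boxes are good again.
      Good : Pred (Box d) _
      Good A = A ∈ 𝓕 × Large 𝒰 (λ B → ∀ i → Separated i A B)

      next : ∀ As → All Good As → ∃ λ B → Good B × All (λ A → ∀ i → Separated i A B) As
      next As good =
        let P , large-P , separates = large-All (All.map proj₂ good)
            B , B∈𝓕 , avoids , B∈P  = large⇒member (large-∩ large-avoids large-P)
        in B , (B∈𝓕 , large-Fin λ i → proj₂ (proj₂ (large-separated (dec i))) B (avoids i)) , separates B B∈P
        where
        large-avoids = large-Fin λ i → proj₁ (proj₂ (large-separated (dec i)))

  ¬FinitelyHit⇒SeparatedSequence : ¬ FinitelyHit 𝓕 → SeparatedSequence 𝓕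
  ¬FinitelyHit⇒SeparatedSequence ¬hit =
    let 𝒰 , decides = decide-list (allFin d) (cofinite ¬hit)
    in separated-sequence 𝒰 λ i → All.lookup decides (∈-allFin i)

corollary9 : ∀ {ℓ} → ExcludedMiddle (suc 0ℓ ⊔ ℓ) →
    (d : ℕ) → 1 ≤ d → (𝓕 : Pred (Box d) ℓ) →
    AmongEveryℵ₀SomeTwoHit 𝓕 → FinitelyHit 𝓕
corollary9 em (ℕ.suc d) _ 𝓕 some-two = decidable-stable em λ ¬hit →
  SeparatedSequence⇒¬SomeTwoHit {𝓕 = 𝓕} (¬FinitelyHit⇒SeparatedSequence em 𝓕 ¬hit) some-two
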